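{- Let $G$ and $H$ be graphs, each with at least $2$ vertices. The lexicographic product $G[H]$ is $1$-perfectly orientable if and only if one of the following holds: (i) $G$ is edgeless and $H$ is $1$-perfectly orientable; (ii) $G$ is $1$-perfectly orientable and $H$ is complete; (iii) every connected component of $G$ is complete and $H$ is a co-bipartite $1$-perfectly orientable graph.
   Context: All graphs are finite and simple. An orientation of a graph $G$ is $1$-perfect if the out-neighborhood of every vertex induces a clique in $G$; $G$ is $1$-perfectly orientable if it admits a $1$-perfect orientation. The lexicographic product $G[H]$ has vertex set $V(G)\times V(H)$, with distinct $(u,v),(u',v')$ adjacent iff either $uu'\in E(G)$, or $u=u'$ and $vv'\in E(H)$. A graph is co-bipartite if its complement is bipartite. -}

module Defs where

open import Data.Bool.Base using (Bool)
open import Data.Fin.Base using (Fin)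
open import Data.Fin.Properties using (*↔×) renaming (_≟_ to _≟ᶠ_)
open import Data.Nat.Base using (ℕ; _*_)
open import Data.Product.Base using (Σ-syntax; _×_; _,_)
open import Data.Product.Function.NonDependent.Propositional using (_×-↔_)
open import Data.Sum.Base using (_⊎_; inj₁; inj₂)
open import Function.Bundles using (_↔_)
open import Function.Construct.Composition using (_↔-∘_)
open import Function.Construct.Symmetry using (↔-sym)
open import Function.Properties.Inverse using (↔⇒↣)
open import Level using (0ℓ)
open import Relation.Binary.Construct.Closure.ReflexiveTransitive using (Star)
open import Relation.Binary.Core using (Rel)
open import Relation.Binary.Definitions using (Decidable; DecidableEquality; Symmetric)
open import Relation.Binary.PropositionalEquality.Core using (_≡_; _≢_; refl; sym; ≢-sym)
open import Relation.Nullary.Decidable using (_×-dec_; _⊎-dec_; ¬?; via-injection)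
open import Relation.Nullary.Negation using (¬_)
open import Relation.Unary using (Pred)

-- Decidability of adjacency, together with the enumeration of the vertices,
-- makes these the classical finite simple graphs.
record Graph : Set₁ where
  infix 4 _~_
  field
    Vertex   : Set
    order    : ℕ
    finite   : Vertex ↔ Fin order
    _~_      : Rel Vertex 0ℓ
    ~-dec    : Decidable _~_
    ~-sym    : Symmetric _~_
    ~-irrefl : ∀ v → ¬ (v ~ v)

  _≟_ : DecidableEquality Vertex
  _≟_ = via-injection (↔⇒↣ finite) _≟ᶠ_

open Graph using (Vertex)

IsClique : (G : Graph) → Pred (Vertex G) 0ℓ → Set
IsClique G S = ∀ u v → S u → S v → u ≢ v → u ~ v
  where open Graph G

Complete : Graph → Set
Complete G = ∀ u v → u ≢ v → u ~ v
  where open Graph G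

Edgeless : Graph → Set
Edgeless G = ∀ u v → ¬ (u ~ v)
  where open Graph G

complement : Graph → Graph
complement G = record
  { Vertex   = G.Vertex
  ; order    = G.order
  ; finite   = G.finite
  ; _~_      = λ u v → u ≢ v × ¬ (u G.~ v)
  ; ~-dec    = λ u v → ¬? (u G.≟ v) ×-dec ¬? (G.~-dec u v)
  ; ~-sym    = λ (u≢v , u≁v) → ≢-sym u≢v , λ v~u → u≁v (G.~-sym v~u)
  ; ~-irrefl = λ v (v≢v , _) → v≢v refl
  }
  where module G = Graph G

Bipartite : Graph → Set
Bipartite G = Σ[ side ∈ (Vertex G → Bool) ] (∀ u v → u ~ v → side u ≢ side v)
  where open Graph G hiding (Vertex)

CoBipartite : Graph → Set
CoBipartite G = Bipartite (complement G)

-- The vertex set of the connected component containing v.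
component : (G : Graph) → Vertex G → Pred (Vertex G) 0ℓ
component G v u = Star (Graph._~_ G) v u

ComponentsComplete : Graph → Set
ComponentsComplete G = ∀ v → IsClique G (component G v)

record Orientation (G : Graph) : Set₁ where
  open Graph G hiding (Vertex)
  infix 4 _⇒_
  field
    _⇒_     : Rel (Vertex G) 0ℓ
    ⇒-edge  : ∀ u v → u ⇒ v → u ~ v
    ⇒-total : ∀ u v → u ~ v → u ⇒ v ⊎ v ⇒ u
    ⇒-asym  : ∀ u v → u ⇒ v → ¬ (v ⇒ u)

  outNeighborhood : Vertex G → Pred (Vertex G) 0ℓ
  outNeighborhood u v = u ⇒ v

OnePerfect : (G : Graph) → Orientation G → Set
OnePerfect G D = ∀ v → IsClique G (Orientation.outNeighborhood D v)

OnePerfectlyOrientable : Graph → Set₁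
OnePerfectlyOrientable G = Σ[ D ∈ Orientation G ] OnePerfect G D

infix 8 _[_]

-- Adjacent pairs are automatically distinct, by irreflexivity in G and H.
_[_] : Graph → Graph → Graph
G [ H ] = record
  { Vertex   = G.Vertex × H.Vertex
  ; order    = G.order * H.order
  ; finite   = ↔-sym *↔× ↔-∘ (G.finite ×-↔ H.finite)
  ; _~_      = adj
  ; ~-dec    = λ (u , v) (u′ , v′) →
                 G.~-dec u u′ ⊎-dec ((u G.≟ u′) ×-dec H.~-dec v v′)
  ; ~-sym    = λ { (inj₁ e)       → inj₁ (G.~-sym e)
                 ; (inj₂ (p , e)) → inj₂ (sym p , H.~-sym e) }
  ; ~-irrefl = λ { (u , v) (inj₁ e)       → G.~-irrefl u e
                 ; (u , v) (inj₂ (_ , e)) → H.~-irrefl v e }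
  }
  where
  module G = Graph G
  module H = Graph H

  adj : Rel (G.Vertex × H.Vertex) 0ℓ
  adj (u , v) (u′ , v′) = u G.~ u′ ⊎ (u ≡ u′ × v H.~ v′)

{-# OPTIONS --safe #-}

-- If p and q are distinct and non-adjacent, no vertex of a 1-perfectly oriented
-- graph points to both, so every common neighbour of p and q is an out-neighbour
-- of p or of q: the common neighbours are covered by two cliques.  If x and y are
-- non-adjacent in H, applying this to (u , x) and (u , y) with uw an edge of G
-- covers the copy of H over w by two cliques, and rules out an induced path
-- a - u - c in G, over whose ends there are three pairwise non-adjacent vertices.
--
-- Conversely, let H be the union of cliques A and B and let the components of G
-- be complete.  For adjacent u < w in G, writing A_u for the copy of A over u,
-- orient cyclically A_u → A_w → B_u → B_w → A_u.  Over each other vertex of G, a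
-- vertex then points to exactly one of the two cliques.
module Submission where

open import Defs
open import Data.Bool.Base using (Bool; true; false)
open import Data.Bool.Properties using () renaming (_≟_ to _≟ᵇ_)
open import Data.Empty using (⊥-elim)
open import Data.Fin.Base using (Fin; zero; _<_)
open import Data.Fin.Properties using (any?; <-asym; <-cmp)
open import Data.Nat.Base using (_≤_; s≤s)
open import Data.Product.Base using (∃-syntax; _×_; _,_; proj₁; proj₂)
open import Data.Sum.Base using (_⊎_; inj₁; inj₂; [_,_]′)
open import Function.Base using (_∘_; const)
open import Function.Bundles using (_⇔_; Inverse; Injection; mk⇔)
open import Function.Properties.Inverse using (↔⇒↣)
open import Level using (0ℓ)
open import Relation.Binary.Construct.Closure.ReflexiveTransitive using (Star; ε; _◅_)
open import Relation.Binary.Definitions using (tri<; tri≈; tri>)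
open import Relation.Binary.PropositionalEquality using (_≡_; _≢_; refl; sym; trans; cong; subst; ≢-sym)
open import Relation.Nullary using (¬_; Dec; yes; no)
open import Relation.Nullary.Decidable using (map′; decidable-stable; ¬?; _×-dec_)
open import Relation.Unary using (Pred) renaming (Decidable to Decidable₁)

open Graph using (Vertex)

-- Finite search, the index order and orientations of a single graph.

module Index (G : Graph) where
  open Graph G hiding (Vertex)

  index : Vertex G → Fin order
  index = Inverse.to finite

  index-injective : ∀ {u v} → index u ≡ index v → u ≡ v
  index-injective = Injection.injective (↔⇒↣ finite)

  index-connex : ∀ {u v} → u ≢ v → index u < index v ⊎ index v < index u
  index-connex {u} {v} u≢v with <-cmp (index u) (index v)
  ... | tri< u<v _ _ = inj₁ u<v
  ... | tri≈ _ u≡v _ = ⊥-elim (u≢v (index-injective u≡v))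
  ... | tri> _ _ v<u = inj₂ v<u

  ~⇒≢ : ∀ {u v} → u ~ v → u ≢ v
  ~⇒≢ u~u refl = ~-irrefl _ u~u

  vertex : 2 ≤ order → Vertex G
  vertex 2≤n = Inverse.from finite (first 2≤n)
    where
    first : ∀ {n} → 2 ≤ n → Fin n
    first (s≤s _) = zero

  -- Vertices are enumerated, so the search runs over `Fin order`. This makes the case splits of the
  -- necessity proof (edge or edgeless, non-edge or complete) constructive.
  ∃? : ∀ {P : Pred (Vertex G) 0ℓ} → Decidable₁ P → Dec (∃[ v ] P v)
  ∃? {P} P? = map′
    (λ (i , p) → Inverse.from finite i , p)
    (λ (v , p) → index v , subst P (sym (Inverse.strictlyInverseʳ finite v)) p)
    (any? (P? ∘ Inverse.from finite))

  edgeless-or-edge : Edgeless G ⊎ ∃[ u ] ∃[ v ] u ~ v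
  edgeless-or-edge with ∃? (λ u → ∃? (~-dec u))
  ... | yes edge = inj₂ edge
  ... | no ¬edge = inj₁ λ u v u~v → ¬edge (u , v , u~v)

  complete-or-nonedge : Complete G ⊎ ∃[ u ] ∃[ v ] (u ≢ v × ¬ (u ~ v))
  complete-or-nonedge with ∃? (λ u → ∃? (λ v → ¬? (u ≟ v) ×-dec ¬? (~-dec u v)))
  ... | yes nonedge = inj₂ nonedge
  ... | no ¬nonedge = inj₁ λ u v u≢v →
    decidable-stable (~-dec u v) λ u≁v → ¬nonedge (u , v , u≢v , u≁v)

  -- An orientation that every graph has. For edgeless and for complete graphs it is 1-perfect at
  -- once, since there any orientation is.
  indexOrientation : Orientation G
  indexOrientation = record
    { _⇒_     = λ u v → u ~ v × index u < index v
    ; ⇒-edge  = λ _ _ → proj₁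
    ; ⇒-total = λ u v u~v → [ (λ u<v → inj₁ (u~v , u<v)) , (λ v<u → inj₂ (~-sym u~v , v<u)) ]′
                              (index-connex (~⇒≢ u~v))
    ; ⇒-asym  = λ _ _ (_ , u<v) (_ , v<u) → <-asym u<v v<u
    }

  edgeless⇒orientable : Edgeless G → OnePerfectlyOrientable G
  edgeless⇒orientable edgeless =
    indexOrientation , λ v u _ (v~u , _) → ⊥-elim (edgeless v u v~u)

  complete⇒orientable : Complete G → OnePerfectlyOrientable G
  complete⇒orientable complete = indexOrientation , λ _ u w _ _ → complete u w

  -- A walk collapses, edge by edge, to an equality or a single edge. Two vertices reachable from
  -- `v` are then joined through `v`.
  transitive⇒componentsComplete :
    (∀ {a b c} → a ~ b → b ~ c → a ≢ c → a ~ c) → ComponentsComplete G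
  transitive⇒componentsComplete ~-trans v u w v⋯u v⋯w u≢w
    with reach v⋯u | reach v⋯w
    where
    reach : ∀ {a b} → Star _~_ a b → a ≡ b ⊎ a ~ b
    reach ε = inj₁ refl
    reach {a} {c} (a~b ◅ b⋯c) with reach b⋯c
    ... | inj₁ refl = inj₂ a~b
    -- The walk may return to its start, where `~-trans` does not apply.
    ... | inj₂ b~c with a ≟ c
    ...   | yes a≡c = inj₁ a≡c
    ...   | no  a≢c = inj₂ (~-trans a~b b~c a≢c)
  ... | inj₁ refl | inj₁ refl = ⊥-elim (u≢w refl)
  ... | inj₁ refl | inj₂ u~w  = u~w
  ... | inj₂ w~u  | inj₁ refl = ~-sym w~u
  ... | inj₂ v~u  | inj₂ v~w  = ~-trans (~-sym v~u) v~w u≢w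

  module _ (D : Orientation G) (perfect : OnePerfect G D) where
    open Orientation D

    commonNeighbour-covered : ∀ {p q z} → p ≢ q → ¬ (p ~ q) →
      p ~ z → q ~ z → p ⇒ z ⊎ q ⇒ z
    commonNeighbour-covered {p} {q} {z} p≢q p≁q p~z q~z
      with ⇒-total p z p~z | ⇒-total q z q~z
    ... | inj₁ p⇒z | _        = inj₁ p⇒z
    ... | inj₂ _   | inj₁ q⇒z = inj₂ q⇒z
    ... | inj₂ z⇒p | inj₂ z⇒q = ⊥-elim (p≁q (perfect z p q z⇒p z⇒q p≢q))

-- `f` embeds `K` as an induced subgraph of `Γ`; restricting the orientation shrinks each
-- out-neighbourhood to a subset of a clique.
orientable-induced : (K Γ : Graph) (f : Vertex K → Vertex Γ) →
  (∀ {u v} → f u ≡ f v → u ≡ v) →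
  (∀ {u v} → Graph._~_ K u v → Graph._~_ Γ (f u) (f v)) →
  (∀ {u v} → Graph._~_ Γ (f u) (f v) → Graph._~_ K u v) →
  OnePerfectlyOrientable Γ → OnePerfectlyOrientable K
orientable-induced K Γ f injective preserves reflects (D , perfect) =
  record
    { _⇒_     = λ u v → f u ⇒ f v
    ; ⇒-edge  = λ u v → reflects ∘ ⇒-edge (f u) (f v)
    ; ⇒-total = λ u v → ⇒-total (f u) (f v) ∘ preserves
    ; ⇒-asym  = λ u v → ⇒-asym (f u) (f v)
    } ,
  λ v u w v⇒u v⇒w u≢w → reflects (perfect (f v) (f u) (f w) v⇒u v⇒w (u≢w ∘ injective))
  where open Orientation D

-- The lexicographic product: its factors, and orientations built from theirs.

module Lexicographic (G H : Graph) where
  private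
    module G where
      open Graph G public
      open Index G public
    module H where
      open Graph H public
      open Index H public
    module GH where
      open Graph (G [ H ]) public
      open Index (G [ H ]) public

  left-orientable : H.Vertex → OnePerfectlyOrientable (G [ H ]) → OnePerfectlyOrientable G
  left-orientable x = orientable-induced G (G [ H ]) (_, x) (cong proj₁) inj₁
    λ { (inj₁ u~v) → u~v ; (inj₂ (_ , x~x)) → ⊥-elim (H.~-irrefl x x~x) }

  right-orientable : G.Vertex → OnePerfectlyOrientable (G [ H ]) → OnePerfectlyOrientable H
  right-orientable u = orientable-induced H (G [ H ]) (u ,_) (cong proj₂) (λ x~y → inj₂ (refl , x~y))
    λ { (inj₁ u~u) → ⊥-elim (G.~-irrefl u u~u) ; (inj₂ (_ , x~y)) → x~y }

  -- `D` orients the edges between fibres and `E` those inside a fibre. Completeness is asked for in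
  -- the presence of an edge of `G`, so that the same construction serves cases (i), where it is
  -- vacuous, and (ii).
  lexicographic-orientable : (∀ {u v} → u G.~ v → Complete H) →
    OnePerfectlyOrientable G → OnePerfectlyOrientable H → OnePerfectlyOrientable (G [ H ])
  lexicographic-orientable complete (D , D-perfect) (E , E-perfect) = orientation , perfect
    where
    module D = Orientation D
    module E = Orientation E

    orientation : Orientation (G [ H ])
    orientation = record
      { _⇒_     = λ (u , x) (v , y) → u D.⇒ v ⊎ (u ≡ v × x E.⇒ y)
      ; ⇒-edge  = λ { _ _ (inj₁ u⇒v)         → inj₁ (D.⇒-edge _ _ u⇒v)
                    ; _ _ (inj₂ (u≡v , x⇒y)) → inj₂ (u≡v , E.⇒-edge _ _ x⇒y) }
      ; ⇒-total = total
      ; ⇒-asym  = asym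
      }
      where
      total : ∀ p q → p GH.~ q → _
      total (u , x) (v , y) (inj₁ u~v) with D.⇒-total u v u~v
      ... | inj₁ u⇒v = inj₁ (inj₁ u⇒v)
      ... | inj₂ v⇒u = inj₂ (inj₁ v⇒u)
      total (u , x) (v , y) (inj₂ (u≡v , x~y)) with E.⇒-total x y x~y
      ... | inj₁ x⇒y = inj₁ (inj₂ (u≡v , x⇒y))
      ... | inj₂ y⇒x = inj₂ (inj₂ (sym u≡v , y⇒x))

      asym : ∀ p q → _ → ¬ _
      asym _ _ (inj₁ u⇒v)          (inj₁ v⇒u)          = D.⇒-asym _ _ u⇒v v⇒u
      asym _ _ (inj₁ u⇒u)          (inj₂ (refl , _))   = D.⇒-asym _ _ u⇒u u⇒u
      asym _ _ (inj₂ (refl , _))   (inj₁ u⇒u)          = D.⇒-asym _ _ u⇒u u⇒u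
      asym _ _ (inj₂ (refl , x⇒y)) (inj₂ (_ , y⇒x))    = E.⇒-asym _ _ x⇒y y⇒x

    perfect : OnePerfect (G [ H ]) orientation
    perfect (u , x) (v , y) (w , z) (inj₁ u⇒v) (inj₁ u⇒w) q≢r with v G.≟ w
    -- Both out-neighbours lie in one foreign fibre, which `D` points to as a whole: it must be a
    -- clique.
    ... | yes refl = inj₂ (refl , complete (D.⇒-edge _ _ u⇒v) y z (q≢r ∘ cong (v ,_)))
    ... | no v≢w   = inj₁ (D-perfect u v w u⇒v u⇒w v≢w)
    perfect _ _ _ (inj₁ u⇒v) (inj₂ (refl , _)) _ = inj₁ (G.~-sym (D.⇒-edge _ _ u⇒v))
    perfect _ _ _ (inj₂ (refl , _)) (inj₁ u⇒w) _ = inj₁ (D.⇒-edge _ _ u⇒w)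
    perfect (u , x) (_ , y) (_ , z) (inj₂ (refl , x⇒y)) (inj₂ (refl , x⇒z)) q≢r =
      inj₂ (refl , E-perfect x y z x⇒y x⇒z (q≢r ∘ cong (u ,_)))

  cyclic-orientable : ComponentsComplete G → CoBipartite H →
    OnePerfectlyOrientable H → OnePerfectlyOrientable (G [ H ])
  cyclic-orientable components (side , alternates) (E , E-perfect) = orientation , perfect
    where
    module E = Orientation E

    sameSide⇒~ : ∀ {x y} → side x ≡ side y → x ≢ y → x H.~ y
    sameSide⇒~ {x} {y} same x≢y =
      decidable-stable (H.~-dec x y) λ x≁y → alternates x y (x≢y , x≁y) same

    ≢-≢⇒≡ : ∀ {a b c : Bool} → a ≢ b → a ≢ c → b ≡ c
    ≢-≢⇒≡ {b = false} {false} _ _ = refl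
    ≢-≢⇒≡ {b = true}  {true}  _ _ = refl
    ≢-≢⇒≡ {false} {false} {true}  a≢b _ = ⊥-elim (a≢b refl)
    ≢-≢⇒≡ {true}  {false} {true}  _ a≢c = ⊥-elim (a≢c refl)
    ≢-≢⇒≡ {false} {true}  {false} _ a≢c = ⊥-elim (a≢c refl)
    ≢-≢⇒≡ {true}  {true}  {false} a≢b _ = ⊥-elim (a≢b refl)

    -- The cyclic rule stated symmetrically in the two cliques: equal sides point up the index
    -- order, opposite sides point down.
    Across : GH.Vertex → GH.Vertex → Set
    Across (u , x) (v , y) =
      (G.index u < G.index v × side x ≡ side y) ⊎ (G.index v < G.index u × side x ≢ side y)

    across-connex : ∀ u x v y → u ≢ v → Across (u , x) (v , y) ⊎ Across (v , y) (u , x)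
    across-connex u x v y u≢v with G.index-connex u≢v | side x ≟ᵇ side y
    ... | inj₁ u<v | yes same = inj₁ (inj₁ (u<v , same))
    ... | inj₁ u<v | no  diff = inj₂ (inj₂ (u<v , ≢-sym diff))
    ... | inj₂ v<u | yes same = inj₂ (inj₁ (v<u , sym same))
    ... | inj₂ v<u | no  diff = inj₁ (inj₂ (v<u , diff))

    across-asym : ∀ p q → Across p q → ¬ Across q p
    across-asym _ _ (inj₁ (u<v , _))    (inj₁ (v<u , _))    = <-asym u<v v<u
    across-asym _ _ (inj₁ (_ , same))   (inj₂ (_ , diff))   = diff (sym same)
    across-asym _ _ (inj₂ (_ , diff))   (inj₁ (_ , same))   = diff (sym same)
    across-asym _ _ (inj₂ (v<u , _))    (inj₂ (u<v , _))    = <-asym u<v v<u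

    -- The order of the two base vertices alone decides whether the arrows from `p` keep its side or
    -- switch it, so those into the fibre over `v` all end in one clique.
    across-sameSide : ∀ p v {y z} → Across p (v , y) → Across p (v , z) → side y ≡ side z
    across-sameSide _ _ (inj₁ (_ , same))  (inj₁ (_ , same′)) = trans (sym same) same′
    across-sameSide _ _ (inj₁ (u<v , _))   (inj₂ (v<u , _))   = ⊥-elim (<-asym u<v v<u)
    across-sameSide _ _ (inj₂ (v<u , _))   (inj₁ (u<v , _))   = ⊥-elim (<-asym u<v v<u)
    across-sameSide _ _ (inj₂ (_ , diff))  (inj₂ (_ , diff′)) = ≢-≢⇒≡ diff diff′

    orientation : Orientation (G [ H ])
    orientation = record
      { _⇒_     = λ (u , x) (v , y) → (u G.~ v × Across (u , x) (v , y)) ⊎ (u ≡ v × x E.⇒ y)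
      ; ⇒-edge  = λ { _ _ (inj₁ (u~v , _))   → inj₁ u~v
                    ; _ _ (inj₂ (u≡v , x⇒y)) → inj₂ (u≡v , E.⇒-edge _ _ x⇒y) }
      ; ⇒-total = total
      ; ⇒-asym  = asym
      }
      where
      total : ∀ p q → p GH.~ q → _
      total (u , x) (v , y) (inj₁ u~v) with across-connex u x v y (G.~⇒≢ u~v)
      ... | inj₁ p⇒q = inj₁ (inj₁ (u~v , p⇒q))
      ... | inj₂ q⇒p = inj₂ (inj₁ (G.~-sym u~v , q⇒p))
      total (u , x) (v , y) (inj₂ (u≡v , x~y)) with E.⇒-total x y x~y
      ... | inj₁ x⇒y = inj₁ (inj₂ (u≡v , x⇒y))
      ... | inj₂ y⇒x = inj₂ (inj₂ (sym u≡v , y⇒x))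

      asym : ∀ p q → _ → ¬ _
      asym p q (inj₁ (_ , p⇒q))    (inj₁ (_ , q⇒p))  = across-asym p q p⇒q q⇒p
      asym _ _ (inj₁ (u~u , _))    (inj₂ (refl , _)) = G.~-irrefl _ u~u
      asym _ _ (inj₂ (refl , _))   (inj₁ (u~u , _))  = G.~-irrefl _ u~u
      asym _ _ (inj₂ (refl , x⇒y)) (inj₂ (_ , y⇒x))  = E.⇒-asym _ _ x⇒y y⇒x

    perfect : OnePerfect (G [ H ]) orientation
    perfect p@(u , x) (v , y) (w , z) (inj₁ (u~v , p⇒q)) (inj₁ (u~w , p⇒r)) q≢r with v G.≟ w
    ... | yes refl = inj₂ (refl , sameSide⇒~ (across-sameSide p v p⇒q p⇒r) (q≢r ∘ cong (v ,_)))
    -- Both `v` and `w` are one step from `u`, hence in its complete component.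
    ... | no v≢w   = inj₁ (components u v w (u~v ◅ ε) (u~w ◅ ε) v≢w)
    perfect _ _ _ (inj₁ (u~v , _)) (inj₂ (refl , _)) _ = inj₁ (G.~-sym u~v)
    perfect _ _ _ (inj₂ (refl , _)) (inj₁ (u~w , _)) _ = inj₁ u~w
    perfect (u , x) (_ , y) (_ , z) (inj₂ (refl , x⇒y)) (inj₂ (refl , x⇒z)) q≢r =
      inj₂ (refl , E-perfect x y z x⇒y x⇒z (q≢r ∘ cong (u ,_)))

  -- Necessity: consequences of a non-edge of `H`.

  module _ (D : Orientation (G [ H ])) (perfect : OnePerfect (G [ H ]) D)
           {x y : H.Vertex} (x≢y : x ≢ y) (x≁y : ¬ (x H.~ y)) where
    open Orientation D

    fibre-≁ : ∀ u → ¬ ((u , x) GH.~ (u , y))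
    fibre-≁ u (inj₁ u~u)       = G.~-irrefl u u~u
    fibre-≁ u (inj₂ (_ , x~y)) = x≁y x~y

    -- An edge `u~w` joins the two fibres completely, so every `(w , z)` is a common neighbour of
    -- the non-adjacent `(u , x)` and `(u , y)`.
    covered : ∀ {u w} → u G.~ w → ∀ z → (u , x) ⇒ (w , z) ⊎ (u , y) ⇒ (w , z)
    covered {u} u~w z =
      GH.commonNeighbour-covered D perfect (x≢y ∘ cong proj₂) (fibre-≁ u) (inj₁ u~w) (inj₁ u~w)

    -- Each `z` is coloured by which of `(u , x)` and `(u , y)` is found to point to `(w , z)`;
    -- vertices of one colour share an out-neighbourhood, hence form a clique.
    right-coBipartite : ∀ {u w} → u G.~ w → CoBipartite H
    right-coBipartite {u} {w} u~w = (λ z → side (covered u~w z)) , alternates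
      where
      side : ∀ {A B : Set} → A ⊎ B → Bool
      side = [ const true , const false ]′

      adjacent : ∀ {p z z′} → p ⇒ (w , z) → p ⇒ (w , z′) → z ≢ z′ → z H.~ z′
      adjacent p⇒z p⇒z′ z≢z′ with perfect _ _ _ p⇒z p⇒z′ (z≢z′ ∘ cong proj₂)
      ... | inj₁ w~w        = ⊥-elim (G.~-irrefl w w~w)
      ... | inj₂ (_ , z~z′) = z~z′

      alternates : ∀ z z′ → z ≢ z′ × ¬ (z H.~ z′) → side (covered u~w z) ≢ side (covered u~w z′)
      alternates z z′ (z≢z′ , z≁z′) same with covered u~w z | covered u~w z′
      ... | inj₁ x⇒z | inj₁ x⇒z′ = z≁z′ (adjacent x⇒z x⇒z′ z≢z′)
      ... | inj₂ y⇒z | inj₂ y⇒z′ = z≁z′ (adjacent y⇒z y⇒z′ z≢z′)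
      alternates z z′ _ () | inj₁ _ | inj₂ _
      alternates z z′ _ () | inj₂ _ | inj₁ _

    fibre-⇏ : ∀ {p u} → p ⇒ (u , x) → ¬ (p ⇒ (u , y))
    fibre-⇏ p⇒q p⇒r = fibre-≁ _ (perfect _ _ _ p⇒q p⇒r (x≢y ∘ cong proj₂))

    out-projections-~ : ∀ {p u w z z′} → u ≢ w → p ⇒ (u , z) → p ⇒ (w , z′) → u G.~ w
    out-projections-~ u≢w p⇒q p⇒r with perfect _ _ _ p⇒q p⇒r (u≢w ∘ cong proj₁)
    ... | inj₁ u~w       = u~w
    ... | inj₂ (u≡w , _) = ⊥-elim (u≢w u≡w)

    -- Pigeonhole: of (a , x), (a , y), (c , x), two lie in the same clique.
    left-transitive : ∀ {a b c} → a G.~ b → b G.~ c → a ≢ c → a G.~ c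
    left-transitive {a} {b} {c} a~b b~c a≢c
      with covered (G.~-sym a~b) x | covered (G.~-sym a~b) y | covered b~c x
    ... | inj₁ p | inj₁ q | _      = ⊥-elim (fibre-⇏ p q)
    ... | inj₂ p | inj₂ q | _      = ⊥-elim (fibre-⇏ p q)
    ... | inj₁ p | inj₂ _ | inj₁ r = out-projections-~ a≢c p r
    ... | inj₁ _ | inj₂ q | inj₂ r = out-projections-~ a≢c q r
    ... | inj₂ _ | inj₁ q | inj₁ r = out-projections-~ a≢c q r
    ... | inj₂ p | inj₁ _ | inj₂ r = out-projections-~ a≢c p r

-- The equivalence, by cases on an edge of `G` and a non-edge of `H`.

theorem8 : (G H : Graph) → 2 ≤ Graph.order G → 2 ≤ Graph.order H →
    OnePerfectlyOrientable (G [ H ]) ⇔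
    ((Edgeless G × OnePerfectlyOrientable H)
    ⊎ (OnePerfectlyOrientable G × Complete H)
    ⊎ (ComponentsComplete G × CoBipartite H × OnePerfectlyOrientable H))
theorem8 G H 2≤G 2≤H = mk⇔ necessary sufficient
  where
  module G = Index G
  module H = Index H
  open Lexicographic G H

  necessary : OnePerfectlyOrientable (G [ H ]) → _
  necessary GH-orientable@(D , perfect) with G.edgeless-or-edge | H.complete-or-nonedge
  -- The bound on the order of `G` supplies a vertex whose fibre is an induced copy of `H`.
  ... | inj₁ edgeless | _ = inj₁ (edgeless , right-orientable (G.vertex 2≤G) GH-orientable)
  ... | inj₂ _ | inj₁ complete = inj₂ (inj₁ (left-orientable (H.vertex 2≤H) GH-orientable , complete))
  ... | inj₂ (u , _ , u~w) | inj₂ (_ , _ , x≢y , x≁y) = inj₂ (inj₂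
    ( G.transitive⇒componentsComplete (left-transitive D perfect x≢y x≁y)
    , right-coBipartite D perfect x≢y x≁y u~w
    , right-orientable u GH-orientable ))

  sufficient : _ → OnePerfectlyOrientable (G [ H ])
  sufficient (inj₁ (edgeless , H-orientable)) =
    lexicographic-orientable (λ u~v → ⊥-elim (edgeless _ _ u~v)) (G.edgeless⇒orientable edgeless) H-orientable
  sufficient (inj₂ (inj₁ (G-orientable , complete))) =
    lexicographic-orientable (const complete) G-orientable (H.complete⇒orientable complete)
  sufficient (inj₂ (inj₂ (components , coBipartite , H-orientable))) =
    cyclic-orientable components coBipartite H-orientable
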